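{- If $G$ is a connected graph that is not $\omega$-evadible, then either $G$ is finite or $G$ has a vertex of infinite degree.
   Context: Cat Herding is played on a simple, possibly infinite graph $G$. The cat first places its token on a vertex. Then the players alternate, the herder moving first: the herder deletes one edge of the current graph, and then, unless the cat's current vertex has degree $0$ in the current graph, the cat moves its token along a finite path with at least one edge in the current graph to a different vertex. The cat is captured when its vertex has degree $0$ in the current graph. $G$ is $k$-evadible if the cat has a strategy (including its choice of starting vertex) that, against every herder strategy, yields a legal cat move after each of the first $k-1$ edge deletions; $G$ is $\omega$-evadible if it is $k$-evadible for every $k\in\mathbb{N}$. -}

module Defs where

open import Level using (Level; suc)
open import Data.Nat using (ℕ; zero; _<_; _∸_)
open import Data.List using (List; []; _∷_)
open import Data.List.Membership.Propositional using (_∈_)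
open import Data.List.Relation.Unary.Unique.Propositional using (Unique)
open import Data.Product using (∃-syntax; _×_; _,_)
open import Data.Sum using (_⊎_; inj₁; inj₂)
open import Function.Bundles using (_⇔_)
open import Relation.Binary.Core using (Rel)
open import Relation.Binary.Definitions using (Symmetric; Irreflexive)
open import Relation.Binary.Construct.Closure.ReflexiveTransitive using (Star; ε; _◅_)
open import Relation.Binary.PropositionalEquality using (_≡_; _≢_; sym)
open import Relation.Nullary using (¬_)
open import Relation.Unary using (Pred)

private variable
  ℓ : Level

record Graph {ℓ : Level} (V : Set ℓ) : Set (suc ℓ) where
  field
    Adj    : Rel V ℓ
    symm   : Symmetric Adj
    irrefl : Irreflexive _≡_ Adj

open Graph public

FiniteSet : {V : Set ℓ} → Pred V ℓ → Set ℓ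
FiniteSet {V = V} P = ∃[ xs ] (∀ (x : V) → P x ⇔ (x ∈ xs))

-- A simple graph with finitely many vertices has finitely many edges.
FiniteGraph : {V : Set ℓ} → Graph V → Set ℓ
FiniteGraph {V = V} G = ∃[ xs ] (∀ (x : V) → x ∈ xs)

InfiniteDegree : {V : Set ℓ} → Graph V → V → Set ℓ
InfiniteDegree G x = ¬ FiniteSet (Adj G x)

DegreeZero : {V : Set ℓ} → Graph V → V → Set ℓ
DegreeZero G x = ∀ y → ¬ Adj G x y

vertices : {V : Set ℓ} {R : Rel V ℓ} {x y : V} → Star R x y → List V
vertices {x = x} ε       = x ∷ []
vertices {x = x} (_ ◅ p) = x ∷ vertices p

record Path {ℓ : Level} {V : Set ℓ} (G : Graph V) (x y : V) : Set ℓ where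
  field
    walk     : Star (Adj G) x y
    distinct : Unique (vertices walk)

Connected : {V : Set ℓ} → Graph V → Set ℓ
Connected G = ∀ x y → Path G x y

-- The pairs (a , b) and (b , a) name the same unordered pair {a , b}.
SamePair : {V : Set ℓ} → V × V → V × V → Set ℓ
SamePair (x , y) (a , b) = (x ≡ a × y ≡ b) ⊎ (x ≡ b × y ≡ a)

deleteEdge : {V : Set ℓ} → Graph V → V × V → Graph V
deleteEdge G e .Adj x y = Adj G x y × ¬ SamePair (x , y) e
deleteEdge G e .symm (xy , ne) = symm G xy , λ where
  (inj₁ (p , q)) → ne (inj₂ (q , p))
  (inj₂ (p , q)) → ne (inj₁ (q , p))
deleteEdge G e .irrefl x≡y (xy , _) = irrefl G x≡y xy

-- A record of complete rounds: `round h e w` extends h by the herder's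
-- deletion of the edge e followed by the cat's move to w. Legality of the
-- moves is imposed separately, by LegalHerder and LegalCatMove.
data History {ℓ : Level} (V : Set ℓ) : Set ℓ where
  start : V → History V
  round : History V → V × V → V → History V

currentGraph : {V : Set ℓ} → Graph V → History V → Graph V
currentGraph G (start _)     = G
currentGraph G (round h e _) = deleteEdge (currentGraph G h) e

catVertex : {V : Set ℓ} → History V → V
catVertex (start v)     = v
catVertex (round _ _ w) = w

record CatStrategy {ℓ : Level} (V : Set ℓ) : Set ℓ where
  field
    startVertex : V
    move        : History V → V × V → V

open CatStrategy public

HerderStrategy : Set ℓ → Set ℓ
HerderStrategy V = History V → V × V

IsEdge : {V : Set ℓ} → Graph V → V × V → Set ℓ
IsEdge G (a , b) = Adj G a b

-- No condition is put on the herder once the cat has been captured: the game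
-- is then over, and there may be no edge left to name.
LegalHerder : {V : Set ℓ} → Graph V → HerderStrategy V → Set ℓ
LegalHerder G τ =
  ∀ h → ¬ DegreeZero (currentGraph G h) (catVertex h) → IsEdge (currentGraph G h) (τ h)

-- A path between different vertices has at least one edge, so a legal move is
-- impossible from a vertex of degree zero.
LegalCatMove : {V : Set ℓ} → Graph V → V → V → Set ℓ
LegalCatMove G v w = v ≢ w × Path G v w

play : {V : Set ℓ} → CatStrategy V → HerderStrategy V → ℕ → History V
play σ τ zero      = start (startVertex σ)
play σ τ (ℕ.suc n) = round h (τ h) (move σ h (τ h))
  where h = play σ τ n

-- The deletion following `play σ τ i` is the (i + 1)-st one. If the cat is
-- captured, the next move fails to be legal, whatever the strategies say.
Evadible : {V : Set ℓ} → Graph V → ℕ → Set ℓ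
Evadible {V = V} G k =
  ∃[ σ ] (∀ (τ : HerderStrategy V) → LegalHerder G τ → ∀ i → i < k ∸ 1 →
    let h = play σ τ i in
    LegalCatMove (deleteEdge (currentGraph G h) (τ h)) (catVertex h) (move σ h (τ h)))

ω-Evadible : {V : Set ℓ} → Graph V → Set ℓ
ω-Evadible G = ∀ k → Evadible G k

{-# OPTIONS --safe #-}

-- If G is infinite and locally finite, then some vertex lies outside the finite
-- ball of radius 2^n around a given vertex, so G contains a path with at least
-- 2^n edges. On such a path the cat halves: standing at an end of an intact path
-- with 2^(m+1) edges it moves to the middle, where two paths with 2^m edges
-- meet, and the next deletion hits at most one of them.

module Submission where

open import Defs
open import Level using (Level)
open import Axiom.ExcludedMiddle using (ExcludedMiddle)
open import Data.List using (List; []; _∷_; concatMap; applyUpTo)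
open import Data.List.Membership.Propositional using (_∈_)
open import Data.List.Membership.Propositional.Properties using (∈-concatMap⁺)
import Data.List.Relation.Unary.All as All
open import Data.List.Relation.Unary.AllPairs using (_∷_)
open import Data.List.Relation.Unary.Any as Any using (here; there)
open import Data.List.Relation.Unary.Unique.Propositional using (Unique)
open import Data.List.Relation.Unary.Unique.Propositional.Properties using (applyUpTo⁺₁)
open import Data.Nat using (ℕ; zero; suc; _+_; _∸_; _^_; _≤_; _<_; z≤n; s≤s; s≤s⁻¹)
open import Data.Nat.Properties
open import Data.Product using (∃-syntax; _×_; _,_; proj₁; proj₂)
open import Data.Sum using (_⊎_; inj₁; inj₂; [_,_]′)
open import Data.Unit.Polymorphic using (⊤)
open import Function using (_∘_)
open import Function.Bundles using (Equivalence)
open import Relation.Binary.Core using (Rel)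
open import Relation.Binary.Construct.Closure.ReflexiveTransitive using (Star; ε; _◅_)
open import Relation.Binary.PropositionalEquality
  using (_≡_; _≢_; refl; sym; trans; cong; subst)
open import Relation.Nullary using (¬_; Dec; yes; no; contradiction)
open import Relation.Nullary.Decidable using (decidable-stable)

private variable
  ℓ : Level
  V : Set ℓ

-- A path as an indexing function, meaningful only up to index `r`: cutting, shifting and reversing
-- become reindexing.
record Arm {V : Set ℓ} (G : Graph V) (f : ℕ → V) (r : ℕ) : Set ℓ where
  field
    adjacent  : ∀ {i} → i < r → Adj G (f i) (f (suc i))
    injective : ∀ {i j} → i ≤ r → j ≤ r → f i ≡ f j → i ≡ j

open Arm

shorten : {G : Graph V} {f : ℕ → V} {r s : ℕ} → s ≤ r → Arm G f r → Arm G f s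
shorten s≤r A .adjacent i<s = A .adjacent (≤-trans i<s s≤r)
shorten s≤r A .injective i≤s j≤s = A .injective (≤-trans i≤s s≤r) (≤-trans j≤s s≤r)

stepsWalk : {R : Rel V ℓ} (f : ℕ → V) (r : ℕ) →
  (∀ {i} → i < r → R (f i) (f (suc i))) → Star R (f 0) (f r)
stepsWalk f zero    step = ε
stepsWalk f (suc r) step = step (s≤s z≤n) ◅ stepsWalk (f ∘ suc) r (step ∘ s≤s)

-- Reduces distinctness to that of an `applyUpTo` list, which follows from injectivity of `f`.
vertices-stepsWalk : {V : Set ℓ} {R : Rel V ℓ} (f : ℕ → V) (r : ℕ)
  (step : ∀ {i} → i < r → R (f i) (f (suc i))) →
  vertices (stepsWalk {R = R} f r step) ≡ applyUpTo f (suc r)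
vertices-stepsWalk f zero    step = refl
vertices-stepsWalk f (suc r) step = cong (f 0 ∷_) (vertices-stepsWalk (f ∘ suc) r (step ∘ s≤s))

armPath : {G : Graph V} {f : ℕ → V} {r : ℕ} → Arm G f r → Path G (f 0) (f r)
armPath {f = f} {r} A .Path.walk = stepsWalk f r (A .adjacent)
armPath {f = f} {r} A .Path.distinct =
  subst Unique (sym (vertices-stepsWalk f r (A .adjacent)))
    (applyUpTo⁺₁ f (suc r) λ i<j j<1+r fi≡fj →
      <⇒≢ i<j (A .injective (≤-trans (<⇒≤ i<j) (s≤s⁻¹ j<1+r)) (s≤s⁻¹ j<1+r) fi≡fj))

armMove : {G : Graph V} {f : ℕ → V} {r : ℕ} → 0 < r → Arm G f r → LegalCatMove G (f 0) (f r)
armMove 0<r A = (λ eq → <⇒≢ 0<r (A .injective z≤n ≤-refl eq)) , armPath A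

forwardArm : {G : Graph V} {f : ℕ → V} (m : ℕ) {r : ℕ} →
  Arm G f (r + m) → Arm G (λ i → f (i + m)) r
forwardArm m A .adjacent i<r = A .adjacent (+-monoˡ-< m i<r)
forwardArm m A .injective {i} {j} i≤r j≤r eq =
  +-cancelʳ-≡ m i j (A .injective (+-monoˡ-≤ m i≤r) (+-monoˡ-≤ m j≤r) eq)

1+[m∸1+n]≡m∸n : ∀ {m n} → n < m → suc (m ∸ suc n) ≡ m ∸ n
1+[m∸1+n]≡m∸n n<m = sym (+-∸-assoc 1 n<m)

backwardArm : {G : Graph V} {f : ℕ → V} {r : ℕ} → Arm G f r → Arm G (λ i → f (r ∸ i)) r
backwardArm {G = G} {f} {r} A .adjacent {i} i<r =
  -- Edge `i` of the reversed arm is edge `r ∸ suc i` of `A`, traversed the other way.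
  symm G (subst (λ k → Adj G (f (r ∸ suc i)) (f k)) eq
    (A .adjacent (subst (_≤ r) (sym eq) (m∸n≤m r i))))
  where eq = 1+[m∸1+n]≡m∸n i<r
backwardArm {r = r} A .injective {i} {j} i≤r j≤r eq =
  ∸-cancelˡ-≡ i≤r j≤r (A .injective (m∸n≤m r i) (m∸n≤m r j) eq)

-- Singles out the second endpoint because two arms leaving the same vertex may share the first one.
samePair-second : {x y x′ y′ : V} {e : V × V} →
  SamePair (x , y) e → SamePair (x′ , y′) e → y ≡ x′ ⊎ y ≡ y′
samePair-second (inj₁ (_ , p)) (inj₁ (_ , q)) = inj₂ (trans p (sym q))
samePair-second (inj₁ (_ , p)) (inj₂ (q , _)) = inj₁ (trans p (sym q))
samePair-second (inj₂ (_ , p)) (inj₁ (q , _)) = inj₁ (trans p (sym q))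
samePair-second (inj₂ (_ , p)) (inj₂ (_ , q)) = inj₂ (trans p (sym q))

-- Beyond the last edge the value stays at `y`, which makes the function total.
along : {R : Rel V ℓ} {x y : V} → Star R x y → ℕ → V
along {x = x} ε       _       = x
along {x = x} (_ ◅ p) zero    = x
along         (_ ◅ p) (suc i) = along p i

edgeCount : {R : Rel V ℓ} {x y : V} → Star R x y → ℕ
edgeCount ε       = 0
edgeCount (_ ◅ p) = suc (edgeCount p)

along-zero : {R : Rel V ℓ} {x y : V} (p : Star R x y) → along p 0 ≡ x
along-zero ε       = refl
along-zero (_ ◅ _) = refl

along-step : {R : Rel V ℓ} {x y : V} (p : Star R x y) {i : ℕ} →
  i < edgeCount p → R (along p i) (along p (suc i))
along-step {R = R} (xz ◅ p) {zero}  _         = subst (R _) (sym (along-zero p)) xz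
along-step         (xz ◅ p) {suc i} (s≤s i<n) = along-step p i<n

along-∈ : {V : Set ℓ} {R : Rel V ℓ} {x y : V} (p : Star R x y) (i : ℕ) → along p i ∈ vertices p
along-∈ ε       _       = here refl
along-∈ (_ ◅ p) zero    = here refl
along-∈ (_ ◅ p) (suc i) = there (along-∈ p i)

along-injective : {V : Set ℓ} {R : Rel V ℓ} {x y : V} (p : Star R x y) → Unique (vertices p) →
  ∀ {i j} → i ≤ edgeCount p → j ≤ edgeCount p → along p i ≡ along p j → i ≡ j
along-injective ε       _ z≤n z≤n _ = refl
along-injective (_ ◅ p) _        {zero}  {zero}  _ _ _ = refl
along-injective (_ ◅ p) (x∉ ∷ _) {zero}  {suc j} _ _ eq =
  contradiction eq (All.lookup x∉ (along-∈ p j))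
along-injective (_ ◅ p) (x∉ ∷ _) {suc i} {zero}  _ _ eq =
  contradiction (sym eq) (All.lookup x∉ (along-∈ p i))
along-injective (_ ◅ p) (_ ∷ u)  {suc i} {suc j} (s≤s i≤n) (s≤s j≤n) eq =
  cong suc (along-injective p u i≤n j≤n eq)

pathArm : {G : Graph V} {x y : V} (P : Path G x y) →
  Arm G (along (Path.walk P)) (edgeCount (Path.walk P))
pathArm P .adjacent  = along-step (Path.walk P)
pathArm P .injective = along-injective (Path.walk P) (Path.distinct P)

module _ {V : Set ℓ} (G : Graph V) (locallyFinite : ∀ x → FiniteSet (Adj G x)) where

  ball : ℕ → V → List V
  ball zero    x = x ∷ []
  -- Keeping `x` at every radius makes the list contain the ends of shorter walks too.
  ball (suc n) x = x ∷ concatMap (ball n) (proj₁ (locallyFinite x))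

  walk⇒∈-ball : ∀ {x y} (p : Star (Adj G) x y) {n} → edgeCount p ≤ n → y ∈ ball n x
  walk⇒∈-ball ε {zero}  _ = here refl
  walk⇒∈-ball ε {suc n} _ = here refl
  walk⇒∈-ball {x} (_◅_ {j = z} xz p) {suc n} (s≤s l≤n) =
    there (∈-concatMap⁺ (ball n) (Any.map (λ { refl → walk⇒∈-ball p l≤n })
      (Equivalence.to (proj₂ (locallyFinite x) z) xz)))

-- The herder is to move in Survives, the cat in Responds.
mutual

  Survives : {V : Set ℓ} → ℕ → Graph V → V → Set ℓ
  Survives         zero    G v = ⊤
  -- `e` is any pair, edge or not, so the herder here is at least as strong as a legal one.
  Survives {V = V} (suc n) G v = ∀ (e : V × V) → Responds n (deleteEdge G e) v

  Responds : {V : Set ℓ} → ℕ → Graph V → V → Set ℓ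
  Responds n G v = ∃[ w ] (LegalCatMove G v w × Survives n G w)

-- A strategy sees only the history, so the number of deletions still to be answered is read off
-- from it.
rounds : History V → ℕ
rounds (start _)     = 0
rounds (round h _ _) = suc (rounds h)

rounds-play : (σ : CatStrategy V) (τ : HerderStrategy V) (i : ℕ) → rounds (play σ τ i) ≡ i
rounds-play σ τ zero    = refl
rounds-play σ τ (suc i) = cong suc (rounds-play σ τ i)

module _ {ℓ : Level} (em : ExcludedMiddle ℓ) {V : Set ℓ} where

  -- Were `e` an edge of both arms, the outer endpoint `f (suc i)` of that edge would lie on `g`.
  -- The start `f 0` is exempt, as the arms may meet there.
  oneArmIntact : {G : Graph V} {f g : ℕ → V} {r : ℕ} → Arm G f r → Arm G g r →
    (∀ i {j} → i < r → j ≤ r → f (suc i) ≢ g j) →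
    ∀ e → Arm (deleteEdge G e) f r ⊎ Arm (deleteEdge G e) g r
  oneArmIntact {f = f} {r = r} A B disjoint e
    with em {P = ∃[ i ] (i < r × SamePair (f i , f (suc i)) e)}
  ... | no  f-avoids = inj₁ λ where
    .adjacent {i} i<r → A .adjacent i<r , λ s → f-avoids (i , i<r , s)
    .injective → A .injective
  ... | yes (i , i<r , s) = inj₂ λ where
    .adjacent j<r → B .adjacent j<r , λ t →
      [ disjoint i i<r (<⇒≤ j<r) , disjoint i i<r j<r ]′ (samePair-second s t)
    .injective → B .injective

  -- The cat is to move. An arm of `2 ^ n` edges pays for `n + 1` moves: one now and one after each
  -- of `n` further deletions.
  arm⇒responds : ∀ n {G : Graph V} {f : ℕ → V} → Arm G f (2 ^ n) → Responds n G (f 0)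
  arm⇒responds zero    A = _ , armMove (s≤s z≤n) A , _
  arm⇒responds (suc n) {G} {f} A = f m , armMove (m^n>0 2 n) half , λ e →
    -- The first half is reversed so that both arms start at the cat's new vertex `f m`.
    [ arm⇒responds n , arm⇒responds n ]′ (oneArmIntact forward (backwardArm half) disjoint e)
    where
    m = 2 ^ n
    whole : Arm G f (m + m)
    whole = subst (Arm G f) (cong (m +_) (+-identityʳ m)) A
    half : Arm G f m
    half = shorten (m≤m+n m m) whole
    forward : Arm G (λ i → f (i + m)) m
    forward = forwardArm m whole
    disjoint : ∀ i {j} → i < m → j ≤ m → f (suc i + m) ≢ f (m ∸ j)
    -- Injectivity of `whole` reduces this to indices: `m ∸ j ≤ m < suc i + m`.
    disjoint i {j} i<m j≤m eq =
      <⇒≢ (≤-<-trans (m∸n≤m m j) (m<n+m m (s≤s z≤n)))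
        (sym (whole .injective (+-monoˡ-≤ m i<m) (≤-trans (m∸n≤m m j) (m≤m+n m m)) eq))

  module _ (G : Graph V) (n : ℕ) where

    respond : ∀ {k H v} → Dec (Responds k H v) → V
    respond         (yes (w , _)) = w
    respond {v = v} (no _)        = v

    respond-correct : ∀ {k H v} (d : Dec (Responds k H v)) → Responds k H v →
      LegalCatMove H v (respond d) × Survives k H (respond d)
    respond-correct (yes (_ , good)) _ = good
    respond-correct (no ¬r)          r = contradiction r ¬r

    survivalStrategy : V → CatStrategy V
    survivalStrategy v .startVertex = v
    survivalStrategy v .move h e =
      -- The pending deletion `e` has number `suc (rounds h)` among the `n` to be answered.
      respond (em {P = Responds (n ∸ suc (rounds h)) (deleteEdge (currentGraph G h) e) (catVertex h)})

    -- Mutual induction with `survivalMove`: the invariant after `i` rounds yields a legal move,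
    -- which restores it for round `suc i`.
    survivesAlongPlay : ∀ {v} → Survives n G v → (τ : HerderStrategy V) →
      let σ = survivalStrategy v in
      ∀ i → i ≤ n → Survives (n ∸ i) (currentGraph G (play σ τ i)) (catVertex (play σ τ i))
    survivalMove : ∀ {v} → Survives n G v → (τ : HerderStrategy V) →
      let σ = survivalStrategy v in
      ∀ i → i < n → let h = play σ τ i; H = deleteEdge (currentGraph G h) (τ h) in
      LegalCatMove H (catVertex h) (move σ h (τ h)) × Survives (n ∸ suc i) H (move σ h (τ h))

    survivesAlongPlay s τ zero    _   = s
    survivesAlongPlay s τ (suc i) i<n = proj₂ (survivalMove s τ i i<n)

    survivalMove {v} s τ i i<n with survivesAlongPlay s τ i (<⇒≤ i<n)
    -- Writing `n ∸ i` as a successor unfolds `Survives`; the other equation matches the count used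
    -- by the strategy with `i`.
    ... | t rewrite sym (1+[m∸1+n]≡m∸n i<n) | rounds-play (survivalStrategy v) τ i =
      respond-correct em (t _)

  survives⇒evadible : ∀ {G : Graph V} {v} k → Survives (k ∸ 1) G v → Evadible G k
  survives⇒evadible {G} {v} k s = survivalStrategy G (k ∸ 1) v ,
    λ τ _ i i<n → proj₁ (survivalMove G (k ∸ 1) s τ i i<n)

  infinite⇒longArm : (G : Graph V) → Connected G → (∀ x → FiniteSet (Adj G x)) →
    ¬ FiniteGraph G → V → ∀ n → ∃[ f ] Arm G f n
  infinite⇒longArm G connected locallyFinite infinite v n
    with em {P = ∃[ x ] (¬ x ∈ ball G locallyFinite n v)}
  ... | no none = contradiction
    (ball G locallyFinite n v , λ x → decidable-stable em λ x∉ → none (x , x∉)) infinite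
  ... | yes (x , x∉) = _ ,
    -- The path to `x` may be longer than `n`; only its first `n` edges are kept.
    shorten (≰⇒≥ λ l≤n → x∉ (walk⇒∈-ball G locallyFinite (Path.walk P) l≤n)) (pathArm P)
    where P = connected v x

  infinite⇒ω-evadible : (G : Graph V) → Connected G → (∀ x → FiniteSet (Adj G x)) →
    ¬ FiniteGraph G → ω-Evadible G
  infinite⇒ω-evadible G connected locallyFinite infinite k with em {P = V}
  -- Without vertices the cat has no start, but then the empty list shows that `G` is finite.
  ... | no  empty = contradiction ([] , λ x → contradiction x empty) infinite
  ... | yes v =
    let _ , A     = infinite⇒longArm G connected locallyFinite infinite v (2 ^ (k ∸ 1))
        -- This response in the undamaged graph is not a move of the game: its target becomes the
        -- start vertex.
        _ , _ , s = arm⇒responds (k ∸ 1) A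
    in survives⇒evadible k s

mainTheorem20 : ∀ {ℓ : Level} → ExcludedMiddle ℓ →
    (V : Set ℓ) (G : Graph V) →
    Connected G →
    ¬ ω-Evadible G →
    FiniteGraph G ⊎ (∃[ v ] InfiniteDegree G v)
mainTheorem20 em V G connected ¬evadible with em {P = FiniteGraph G} | em {P = ∃[ v ] InfiniteDegree G v}
... | yes finite | _     = inj₁ finite
... | no  _      | yes d = inj₂ d
... | no  infinite | no none = contradiction
  (infinite⇒ω-evadible em G connected
    (λ x → decidable-stable em λ inf → none (x , inf)) infinite) ¬evadible
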